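{- Let $\mathbb{M} = \langle W, \{\sim_i\}_{i \in G}, \{\leq_{i,w}\}_{i \in G}^{w \in W}, V\rangle$ and $\mathbb{M}' = \langle W', \{\sim'_i\}_{i \in G}, \{\leq'_{i,w'}\}_{i \in G}^{w' \in W'}, V'\rangle$ be uniform and locally connected epistemic plausibility models, let $w\in W$ and $w'\in W'$, and let $Z\subseteq W\times W'$ be a $\{K,B^+\}$-bisimulation with $(w,w')\in Z$. Let $\varphi\in\mathcal{L}(K,B^+,B^c)$ be an arbitrary formula. Then: 1. If $\mathbb{M},w\models\varphi$ and $\mathbb{M}',w'\models\varphi$, then for all $\psi\in\mathcal{L}(K,B^+,B^c)$: $\mathbb{M}!\varphi,w\models\psi\Leftrightarrow\mathbb{M}'!\varphi,w'\models\psi$. 2. For all $\psi\in\mathcal{L}(K,B^+,B^c)$: $\mathbb{M}\Uparrow\varphi,w\models\psi\Leftrightarrow\mathbb{M}'\Uparrow\varphi,w'\models\psi$.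
   Context: Fix a non-empty set $G$ of agents and a countably infinite set $Prop$ of proposition letters. Models. An epistemic plausibility model is a structure $\mathbb{M} = \langle W, \{\sim_i\}_{i \in G}, \{\leq_{i,w}\}_{i \in G}^{w \in W}, V\rangle$ where $W$ is a non-empty set of states, each $\sim_i \subseteq W\times W$ is an equivalence relation, each $\leq_{i,w} \subseteq W \times W$ is a well-founded pre-order, and $V : Prop \to \wp(W)$. For $X \subseteq W$, $\mathrm{Min}_{\leq_{i,w}}(X) := \{x \in X \mid \forall y \in X: y \leq_{i,w} x \Rightarrow x \leq_{i,w} y\}$. A well-founded pre-order is a reflexive transitive relation (not necessarily total) such that $\mathrm{Min}_{\leq_{i,w}}(X) \neq \emptyset$ for every non-empty $X \subseteq W$. Write $[w]_{\sim_i} := \{v \in W \mid w \sim_i v\}$. The model is uniform iff for all $i\in G$ and $w,v\in W$: if $w\sim_i v$ then $\leq_{i,w}=\leq_{i,v}$. It is locally connected iff for all $i\in G$ and $w,v\in W$: if $w\sim_i v$ then $w\leq_{i,w}v$ or $v\leq_{i,w}w$. Language and semantics. $\mathcal{L}(K,B^+,B^c)$ is built from proposition letters $p\in Prop$ using $\neg$, $\wedge$, and (for all $i\in G$) the operators $K_i\varphi$, $B_i^+\varphi$ and $B_i^\alpha\varphi$ ($\alpha,\varphi$ both formulas of the language). Proposition letters (via $V$) and Booleans are interpreted as usual; $[\![\alpha]\!]^{\mathbb{M}} := \{w \in W \mid \mathbb{M},w\models\alpha\}$; $\mathbb{M},w \models K_i\varphi$ iff $\forall v \in [w]_{\sim_i}: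 \mathbb{M},v\models\varphi$; $\mathbb{M},w \models B_i^\alpha\varphi$ iff $\forall v \in \mathrm{Min}_{\leq_{i,w}}([\![\alpha]\!]^{\mathbb{M}} \cap [w]_{\sim_i}): \mathbb{M},v\models\varphi$; $\mathbb{M},w \models B_i^+\varphi$ iff $\forall v \in [w]_{\sim_i}: v \leq_{i,w} w \Rightarrow \mathbb{M},v\models\varphi$. Model changes. For a formula $\varphi$: - (public announcement) $\mathbb{M}!\varphi$ has set of states $[\![\varphi]\!]^{\mathbb{M}}$, relations $\sim_i^{!\varphi} := \sim_i\cap([\![\varphi]\!]^{\mathbb{M}}\times[\![\varphi]\!]^{\mathbb{M}})$ and $\leq_{i,w}^{!\varphi} := \leq_{i,w}\cap([\![\varphi]\!]^{\mathbb{M}}\times[\![\varphi]\!]^{\mathbb{M}})$ for $w\in[\![\varphi]\!]^{\mathbb{M}}$, and valuation $V^{!\varphi}(p) := V(p)\cap[\![\varphi]\!]^{\mathbb{M}}$. - (radical upgrade) $\mathbb{M}\Uparrow\varphi$ has the same states, the same $\sim_i$ and the same valuation as $\mathbb{M}$, and $\leq_{i,w}^{\Uparrow\varphi} := (\leq_{i,w}\cap([\![\varphi]\!]^{\mathbb{M}}\times[\![\varphi]\!]^{\mathbb{M}}))\cup(\leq_{i,w}\cap([\![\neg\varphi]\!]^{\mathbb{M}}\times[\![\neg\varphi]\!]^{\mathbb{M}}))\cup([\![\varphi]\!]^{\mathbb{M}}\times[\![\neg\varphi]\!]^{\mathbb{M}})$ for all $w\in W$. Bisimulation. $Z\subseteq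 W\times W'$ is a $\{K,B^+\}$-bisimulation iff for all $(w,w')\in Z$ and $i\in G$: - for all $p\in Prop$: $w\in V(p)\Leftrightarrow w'\in V'(p)$; - if $w\sim_i v$, then there is $v'\in W'$ with $(v,v')\in Z$ and $w'\sim'_i v'$; and if $w'\sim'_i v'$, then there is $v\in W$ with $(v,v')\in Z$ and $w\sim_i v$; - if $w\sim_i v$ and $v\leq_{i,w} w$, then there is $v'\in W'$ with $(v,v')\in Z$, $w'\sim'_i v'$ and $v'\leq'_{i,w'}w'$; and if $w'\sim'_i v'$ and $v'\leq'_{i,w'}w'$, then there is $v\in W$ with $(v,v')\in Z$, $w\sim_i v$ and $v\leq_{i,w}w$. -}

module Defs where

open import Level using (Level; _⊔_; suc)
open import Data.Product using (_×_; _,_; ∃-syntax)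
open import Data.Sum using (_⊎_)
open import Data.Refinement.Base using (Refinement; value)
open import Function.Bundles using (_⇔_)
open import Relation.Binary.Core using (REL; Rel)
open import Relation.Binary.Definitions using (Reflexive; Transitive)
open import Relation.Binary.Structures using (IsEquivalence)
open import Relation.Nullary.Negation using (¬_)
open import Relation.Unary using (Pred; _∈_; _∩_; Satisfiable)

Min : ∀ {ℓ} {W : Set ℓ} → Rel W ℓ → Pred W ℓ → Pred W ℓ
Min _≤_ X x = x ∈ X × (∀ y → y ∈ X → y ≤ x → x ≤ y)

record IsWellFoundedPreorder {ℓ} {W : Set ℓ} (_≤_ : Rel W ℓ) : Set (suc ℓ) where
  field
    reflexive  : Reflexive _≤_
    transitive : Transitive _≤_
    minima     : ∀ (X : Pred W ℓ) → Satisfiable X → Satisfiable (Min _≤_ X)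

module _ {g p : Level} (G : Set g) (Atom : Set p) where

  -- The data of a model, without its laws: the semantics and the model
  -- changes depend only on the data.
  record Structure (ℓ : Level) : Set (g ⊔ p ⊔ suc ℓ) where
    field
      W   : Set ℓ
      sim : G → Rel W ℓ
      leq : G → W → Rel W ℓ
      V   : Atom → Pred W ℓ

    infix 4 _∼[_]_ _≤[_,_]_

    _∼[_]_ : W → G → W → Set ℓ
    w ∼[ i ] v = sim i w v

    _≤[_,_]_ : W → G → W → W → Set ℓ
    u ≤[ i , w ] v = leq i w u v

    cell : G → W → Pred W ℓ
    cell i w v = w ∼[ i ] v

  data Formula : Set (g ⊔ p) where
    atom : Atom → Formula
    neg  : Formula → Formula
    _∧′_ : Formula → Formula → Formula
    K    : G → Formula → Formula
    B⁺   : G → Formula → Formula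
    -- B i α φ is belief in φ conditional on α.
    B    : G → Formula → Formula → Formula

module _ {g p ℓ : Level} {G : Set g} {Atom : Set p} where

  open Structure using (W)

  record IsEpistemicPlausibilityModel (M : Structure G Atom ℓ) : Set (g ⊔ suc ℓ) where
    open Structure M hiding (W)
    field
      nonEmpty              : W M
      isEquivalence         : ∀ i → IsEquivalence (sim i)
      isWellFoundedPreorder : ∀ i w → IsWellFoundedPreorder (leq i w)

  Uniform : Structure G Atom ℓ → Set (g ⊔ ℓ)
  Uniform M = ∀ i w v → w ∼[ i ] v → ∀ x y → x ≤[ i , w ] y ⇔ x ≤[ i , v ] y
    where open Structure M

  LocallyConnected : Structure G Atom ℓ → Set (g ⊔ ℓ)
  LocallyConnected M = ∀ i w v → w ∼[ i ] v → w ≤[ i , w ] v ⊎ v ≤[ i , w ] w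
    where open Structure M

  infix 3 _∣_⊨_

  _∣_⊨_ : (M : Structure G Atom ℓ) → W M → Formula G Atom → Set ℓ
  M ∣ w ⊨ atom a  = w ∈ Structure.V M a
  M ∣ w ⊨ neg φ   = ¬ (M ∣ w ⊨ φ)
  M ∣ w ⊨ φ ∧′ ψ  = (M ∣ w ⊨ φ) × (M ∣ w ⊨ ψ)
  M ∣ w ⊨ K i φ   = ∀ v → v ∈ Structure.cell M i w → M ∣ v ⊨ φ
  M ∣ w ⊨ B⁺ i φ  = ∀ v → v ∈ Structure.cell M i w → Structure.leq M i w v w → M ∣ v ⊨ φ
  M ∣ w ⊨ B i α φ =
    ∀ v → v ∈ Min (Structure.leq M i w) ((λ u → M ∣ u ⊨ α) ∩ Structure.cell M i w) →
    M ∣ v ⊨ φ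

  ⟦_⟧ : Formula G Atom → (M : Structure G Atom ℓ) → Pred (W M) ℓ
  ⟦ φ ⟧ M w = M ∣ w ⊨ φ

  infixl 6 _!_ _⇑_

  -- A state of M ! φ is a state of M with an irrelevant proof that it
  -- satisfies φ, so distinct proofs do not give distinct states.
  _!_ : Structure G Atom ℓ → Formula G Atom → Structure G Atom ℓ
  M ! φ = record
    { W   = Refinement (W M) (⟦ φ ⟧ M)
    ; sim = λ i u v → value u ∼[ i ] value v
    ; leq = λ i w u v → value u ≤[ i , value w ] value v
    ; V   = λ a u → value u ∈ V a
    }
    where open Structure M hiding (W)

  _⇑_ : Structure G Atom ℓ → Formula G Atom → Structure G Atom ℓ
  M ⇑ φ = record
    { W   = W M
    ; sim = sim
    ; leq = λ i w u v →
          (u ≤[ i , w ] v × u ∈ ⟦ φ ⟧ M × v ∈ ⟦ φ ⟧ M)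
        ⊎ (u ≤[ i , w ] v × u ∈ ⟦ neg φ ⟧ M × v ∈ ⟦ neg φ ⟧ M)
        ⊎ (u ∈ ⟦ φ ⟧ M × v ∈ ⟦ neg φ ⟧ M)
    ; V   = V
    }
    where open Structure M hiding (W)

  record IsBisimulation (M M′ : Structure G Atom ℓ) (Z : REL (W M) (W M′) ℓ)
         : Set (g ⊔ p ⊔ ℓ) where
    private
      module M  = Structure M
      module M′ = Structure M′
    field
      atoms : ∀ {w w′} → Z w w′ → ∀ a → w ∈ M.V a ⇔ w′ ∈ M′.V a
      K-zig : ∀ {w w′} → Z w w′ → ∀ i v → w M.∼[ i ] v →
              ∃[ v′ ] Z v v′ × w′ M′.∼[ i ] v′
      K-zag : ∀ {w w′} → Z w w′ → ∀ i v′ → w′ M′.∼[ i ] v′ →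
              ∃[ v ] Z v v′ × w M.∼[ i ] v
      B⁺-zig : ∀ {w w′} → Z w w′ → ∀ i v → w M.∼[ i ] v → v M.≤[ i , w ] w →
               ∃[ v′ ] Z v v′ × w′ M′.∼[ i ] v′ × v′ M′.≤[ i , w′ ] w′
      B⁺-zag : ∀ {w w′} → Z w w′ → ∀ i v′ → w′ M′.∼[ i ] v′ → v′ M′.≤[ i , w′ ] w′ →
               ∃[ v ] Z v v′ × w M.∼[ i ] v × v M.≤[ i , w ] w

{-# OPTIONS --safe #-}

-- Over uniform models, satisfaction is invariant under {K,B⁺}-bisimulations, and the
-- bisimulation between M and M′ remains one, between models of the same kind, after
-- announcing or upgrading with φ, because φ itself is invariant. The delicate clause
-- of the invariance is conditional belief: a bisimilar partner of a minimal state need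
-- not be minimal, but by well-foundedness some partner is minimal among all partners
-- within the cell, and that one is minimal in the condition as well.
module Submission where

open import Defs
open import Axiom.ExcludedMiddle using (ExcludedMiddle)
open import Data.Irrelevant using ([_])
open import Data.Nat.Base using (ℕ)
open import Data.Product using (_×_; _,_; ∃-syntax)
open import Data.Refinement.Base using (_,_; value)
open import Data.Sum using (_⊎_; inj₁; inj₂)
open import Function.Base using (flip; _on_)
open import Function.Bundles using (_⇔_; _⤖_; mk⇔; Equivalence)
open import Function.Construct.Symmetry using (⇔-sym)
open import Level using (Level; _⊔_; suc)
open import Relation.Binary.Construct.On using () renaming (isEquivalence to on-isEquivalence)
open import Relation.Binary.Core using (REL; Rel)
open import Relation.Binary.PropositionalEquality.Core using (_≡_; refl)
open import Relation.Binary.Structures using (IsEquivalence)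
open import Relation.Nullary.Decidable.Core using (Dec; yes; no)
open import Relation.Nullary.Negation using (contradiction)
open import Relation.Unary using (Pred; _∈_; _∉_; _∩_; Satisfiable)

open Equivalence using (to; from)
open Structure using (W)

-- Well-founded preorders under pullback and under upgrade.

on-isWellFoundedPreorder :
  ∀ {ℓ} {A B : Set ℓ} (f : B → A) {_≤_ : Rel A ℓ} →
  IsWellFoundedPreorder _≤_ → IsWellFoundedPreorder (_≤_ on f)
on-isWellFoundedPreorder f {_≤_} wf = record
  { reflexive  = reflexive
  ; transitive = transitive
  ; minima     = on-minima
  }
  where
  open IsWellFoundedPreorder wf

  on-minima : ∀ X → Satisfiable X → Satisfiable (Min (_≤_ on f) X)
  on-minima X (x , x∈X)
    -- The image of `X` under `f`: any preimage in `X` of a minimal element of it is minimal for the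
    -- pulled-back order.
    with minima (λ a → ∃[ b ] b ∈ X × f b ≡ a) (f x , x , x∈X , refl)
  ... | _ , (b , b∈X , refl) , least =
    b , b∈X , λ y y∈X y≤b → least (f y) (y , y∈X , refl) y≤b

module _ {ℓ : Level} {A : Set ℓ} (_≤_ : Rel A ℓ) (P : Pred A ℓ) where

  -- At `P = ⟦ φ ⟧ M` this unfolds to the order of `M ⇑ φ`, so facts about it apply there directly.
  Upgrade : Rel A ℓ
  Upgrade x y = (x ≤ y × x ∈ P × y ∈ P) ⊎ (x ≤ y × x ∉ P × y ∉ P) ⊎ (x ∈ P × y ∉ P)

  -- Every state in `P` is placed below every state outside it. So if `X` meets `P`, a minimum of
  -- `X ∩ P` is a minimum of `X`; otherwise `X` lies outside `P`, where the old order is unchanged.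
  -- Excluded middle decides this case split and, for reflexivity, membership of a state in `P`.
  upgrade-isWellFoundedPreorder :
    ExcludedMiddle ℓ → IsWellFoundedPreorder _≤_ → IsWellFoundedPreorder Upgrade
  upgrade-isWellFoundedPreorder em wf = record
    { reflexive  = upgrade-refl em
    ; transitive = upgrade-trans
    ; minima     = λ X sat → upgrade-minima X sat em
    }
    where
    open IsWellFoundedPreorder wf

    upgrade-refl : ∀ {x} → Dec (x ∈ P) → Upgrade x x
    upgrade-refl (yes x∈P) = inj₁ (reflexive , x∈P , x∈P)
    upgrade-refl (no  x∉P) = inj₂ (inj₁ (reflexive , x∉P , x∉P))

    upgrade-trans : ∀ {x y z} → Upgrade x y → Upgrade y z → Upgrade x z
    upgrade-trans (inj₁ (x≤y , x∈ , _)) (inj₁ (y≤z , _ , z∈)) = inj₁ (transitive x≤y y≤z , x∈ , z∈)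
    upgrade-trans (inj₁ (_ , _ , y∈)) (inj₂ (inj₁ (_ , y∉ , _))) = contradiction y∈ y∉
    upgrade-trans (inj₁ (_ , x∈ , _)) (inj₂ (inj₂ (_ , z∉))) = inj₂ (inj₂ (x∈ , z∉))
    upgrade-trans (inj₂ (inj₁ (_ , _ , y∉))) (inj₁ (_ , y∈ , _)) = contradiction y∈ y∉
    upgrade-trans (inj₂ (inj₁ (x≤y , x∉ , _))) (inj₂ (inj₁ (y≤z , _ , z∉))) =
      inj₂ (inj₁ (transitive x≤y y≤z , x∉ , z∉))
    upgrade-trans (inj₂ (inj₁ (_ , _ , y∉))) (inj₂ (inj₂ (y∈ , _))) = contradiction y∈ y∉
    upgrade-trans (inj₂ (inj₂ (_ , y∉))) (inj₁ (_ , y∈ , _)) = contradiction y∈ y∉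
    upgrade-trans (inj₂ (inj₂ (x∈ , _))) (inj₂ (inj₁ (_ , _ , z∉))) = inj₂ (inj₂ (x∈ , z∉))
    upgrade-trans (inj₂ (inj₂ (_ , y∉))) (inj₂ (inj₂ (y∈ , _))) = contradiction y∈ y∉

    upgrade-minima : ∀ X → Satisfiable X → Dec (Satisfiable (X ∩ P)) →
                     Satisfiable (Min Upgrade X)
    upgrade-minima X _ (yes sat) with minima (X ∩ P) sat
    ... | x , (x∈X , x∈P) , least = x , x∈X , λ where
      y y∈X (inj₁ (y≤x , y∈P , _))        → inj₁ (least y (y∈X , y∈P) y≤x , x∈P , y∈P)
      y y∈X (inj₂ (inj₁ (_ , _ , x∉P)))   → contradiction x∈P x∉P
      y y∈X (inj₂ (inj₂ (_ , x∉P)))       → contradiction x∈P x∉P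
    upgrade-minima X sat (no ¬sat) with minima X sat
    ... | x , x∈X , least = x , x∈X , λ where
      y y∈X (inj₁ (_ , y∈P , _))              → contradiction (y , y∈X , y∈P) ¬sat
      y y∈X (inj₂ (inj₁ (y≤x , y∉P , x∉P)))   → inj₂ (inj₁ (least y y∈X y≤x , x∉P , y∉P))
      y y∈X (inj₂ (inj₂ (y∈P , _)))           → contradiction (y , y∈X , y∈P) ¬sat

-- Uniform models, bisimulations between them and invariance of satisfaction.

module _ {g p ℓ : Level} {G : Set g} {Atom : Set p} where

  record IsUniformModel (M : Structure G Atom ℓ) : Set (g ⊔ suc ℓ) where
    field
      isModel : IsEpistemicPlausibilityModel M
      uniform : Uniform M

    open Structure M hiding (W)
    open IsEpistemicPlausibilityModel isModel public

    module ∼ (i : G) = IsEquivalence (isEquivalence i)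
    module ≤ (i : G) (w : W M) = IsWellFoundedPreorder (isWellFoundedPreorder i w)

    ≤-shift : ∀ {i w v x y} → w ∼[ i ] v → x ≤[ i , w ] y → x ≤[ i , v ] y
    ≤-shift w∼v = to (uniform _ _ _ w∼v _ _)

    ∼-euclidean : ∀ {i w x y} → w ∼[ i ] x → w ∼[ i ] y → x ∼[ i ] y
    ∼-euclidean w∼x w∼y = ∼.trans _ (∼.sym _ w∼x) w∼y

  record UniformBisimulation (M M′ : Structure G Atom ℓ) (Z : REL (W M) (W M′) ℓ)
         : Set (g ⊔ p ⊔ suc ℓ) where
    field
      left           : IsUniformModel M
      right          : IsUniformModel M′
      isBisimulation : IsBisimulation M M′ Z

    open IsBisimulation isBisimulation public

  -- This symmetry lets `⊨-transfer` and `⇑-B⁺-zig` be proved in one direction only.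
  converse : ∀ {M M′ Z} → UniformBisimulation M M′ Z → UniformBisimulation M′ M (flip Z)
  converse Zb = record
    { left  = right
    ; right = left
    ; isBisimulation = record
      { atoms  = λ z a → ⇔-sym (atoms z a)
      ; K-zig  = K-zag
      ; K-zag  = K-zig
      ; B⁺-zig = B⁺-zag
      ; B⁺-zag = B⁺-zig
      }
    }
    where open UniformBisimulation Zb

  -- The condition is a pair of predicates matched along `Z` rather than a formula, so that the
  -- induction hypothesis for `α` in `⊨-transfer` can supply the match.
  Min-zag :
    ∀ {M M′ Z} → UniformBisimulation M M′ Z →
    (P : Pred (W M) ℓ) (P′ : Pred (W M′) ℓ) → (∀ {u u′} → Z u u′ → u ∈ P ⇔ u′ ∈ P′) →
    ∀ {w w′} → Z w w′ → ∀ i v′ →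
    v′ ∈ Min (Structure.leq M′ i w′) (P′ ∩ Structure.cell M′ i w′) →
    ∃[ v ] Z v v′ × v ∈ Min (Structure.leq M i w) (P ∩ Structure.cell M i w)
  Min-zag {M} {M′} {Z} Zb P P′ P⇔P′ {w} {w′} z i v′ ((v′∈P′ , w′∼v′) , v′-least)
    with UniformBisimulation.K-zag Zb z i v′ w′∼v′
  ... | v₀ , z₀ , w∼v₀
    with IsUniformModel.≤.minima (UniformBisimulation.left Zb) i w
           -- Every state of this set lies in `P`, because its partner `v′` lies in `P′`.
           (λ x → Z x v′ × Structure.sim M i w x) (v₀ , z₀ , w∼v₀)
  ... | v , (zv , w∼v) , v-least = v , zv , (from (P⇔P′ zv) v′∈P′ , w∼v) , least
    where
    open Structure M using (_≤[_,_]_)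
    open UniformBisimulation Zb
    module L = IsUniformModel left
    module R = IsUniformModel right

    -- Going to y′ below v′ and back along v′ ≤ y′ yields a partner u of v′ below y.
    least : ∀ y → y ∈ P ∩ Structure.cell M i w → y ≤[ i , w ] v → v ≤[ i , w ] y
    least y (y∈P , w∼y) y≤v
      -- The `B⁺` clauses read the order based at the related states themselves, so uniformity
      -- carries each comparison there from `w` or `w′`, and back afterwards.
      with B⁺-zig zv i y (L.∼-euclidean w∼v w∼y) (L.≤-shift w∼v y≤v)
    ... | y′ , zy , v′∼y′ , y′≤v′
      with R.∼.trans i w′∼v′ v′∼y′
    ... | w′∼y′
      with v′-least y′ (to (P⇔P′ zy) y∈P , w′∼y′) (R.≤-shift (R.∼.sym i w′∼v′) y′≤v′)
    ... | v′≤y′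
      with B⁺-zag zy i v′ (R.∼.sym i v′∼y′) (R.≤-shift w′∼y′ v′≤y′)
    ... | u , zu , y∼u , u≤y
      with L.≤-shift (L.∼.sym i w∼y) u≤y
    ... | u≤y =
      -- From `u ≤ y ≤ v` and the choice of `v` among the partners of `v′` follows `v ≤ u`, hence
      -- `v ≤ u ≤ y`.
      L.≤.transitive i w
        (v-least u (zu , L.∼.trans i w∼y y∼u) (L.≤.transitive i w u≤y y≤v)) u≤y

  -- Induction on `φ` with the bisimulation left to vary, since negation and the condition `α` of
  -- conditional belief call the hypothesis for `converse Zb`.
  ⊨-transfer :
    ∀ {M M′ Z} (φ : Formula G Atom) → UniformBisimulation M M′ Z →
    ∀ {w w′} → Z w w′ → M ∣ w ⊨ φ → M′ ∣ w′ ⊨ φ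
  ⊨-transfer (atom a) Zb z h = to (UniformBisimulation.atoms Zb z a) h
  ⊨-transfer (neg φ) Zb z h h′ = h (⊨-transfer φ (converse Zb) z h′)
  ⊨-transfer (φ ∧′ ψ) Zb z (h , k) = ⊨-transfer φ Zb z h , ⊨-transfer ψ Zb z k
  ⊨-transfer (K i φ) Zb z h v′ w′∼v′ with UniformBisimulation.K-zag Zb z i v′ w′∼v′
  ... | v , zv , w∼v = ⊨-transfer φ Zb zv (h v w∼v)
  ⊨-transfer (B⁺ i φ) Zb z h v′ w′∼v′ v′≤w′
    with UniformBisimulation.B⁺-zag Zb z i v′ w′∼v′ v′≤w′
  ... | v , zv , w∼v , v≤w = ⊨-transfer φ Zb zv (h v w∼v v≤w)
  ⊨-transfer {M} {M′} (B i α φ) Zb z h v′ v′-min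
    with Min-zag Zb (⟦ α ⟧ M) (⟦ α ⟧ M′)
           (λ zu → mk⇔ (⊨-transfer α Zb zu) (⊨-transfer α (converse Zb) zu)) z i v′ v′-min
  ... | v , zv , v-min = ⊨-transfer φ Zb zv (h v v-min)

  ⊨-invariant :
    ∀ {M M′ Z} (φ : Formula G Atom) → UniformBisimulation M M′ Z →
    ∀ {w w′} → Z w w′ → (M ∣ w ⊨ φ) ⇔ (M′ ∣ w′ ⊨ φ)
  ⊨-invariant φ Zb z = mk⇔ (⊨-transfer φ Zb z) (⊨-transfer φ (converse Zb) z)

  -- Bisimulations after announcement and after upgrade.

  !-isUniformModel : ∀ {M} φ → W (M ! φ) → IsUniformModel M → IsUniformModel (M ! φ)
  !-isUniformModel φ w uM = record
    { isModel = record
      -- An announcement may eliminate every state, so a survivor has to be supplied from outside.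
      { nonEmpty              = w
      ; isEquivalence         = λ i → on-isEquivalence value (isEquivalence i)
      ; isWellFoundedPreorder = λ i u →
          on-isWellFoundedPreorder value (isWellFoundedPreorder i (value u))
      }
    ; uniform = λ i u v u∼v x y → uniform i (value u) (value v) u∼v (value x) (value y)
    }
    where open IsUniformModel uM

  -- Partners of surviving states survive, because `φ` itself transfers along `Z`.
  !-bisimulation :
    ∀ {M M′ Z} φ → W (M ! φ) → W (M′ ! φ) → UniformBisimulation M M′ Z →
    UniformBisimulation (M ! φ) (M′ ! φ) (λ u u′ → Z (value u) (value u′))
  !-bisimulation φ w w′ Zb = record
    { left  = !-isUniformModel φ w left
    ; right = !-isUniformModel φ w′ right
    ; isBisimulation = record
      { atoms  = atoms
      ; K-zig  = λ where
          -- The proof `h` is irrelevant, which suffices because it is used only to build another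
          -- irrelevant proof.
          z i (v , [ h ]) w∼v → let v′ , zv , r = K-zig z i v w∼v in
            (v′ , [ ⊨-transfer φ Zb zv h ]) , zv , r
      ; K-zag  = λ where
          z i (v′ , [ h ]) w′∼v′ → let v , zv , r = K-zag z i v′ w′∼v′ in
            (v , [ ⊨-transfer φ (converse Zb) zv h ]) , zv , r
      ; B⁺-zig = λ where
          z i (v , [ h ]) w∼v v≤w → let v′ , zv , r = B⁺-zig z i v w∼v v≤w in
            (v′ , [ ⊨-transfer φ Zb zv h ]) , zv , r
      ; B⁺-zag = λ where
          z i (v′ , [ h ]) w′∼v′ v′≤w′ → let v , zv , r = B⁺-zag z i v′ w′∼v′ v′≤w′ in
            (v , [ ⊨-transfer φ (converse Zb) zv h ]) , zv , r
      }
    }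
    where open UniformBisimulation Zb

  module _ (em : ExcludedMiddle ℓ) where

    ⇑-isUniformModel : ∀ {M} φ → IsUniformModel M → IsUniformModel (M ⇑ φ)
    ⇑-isUniformModel {M} φ uM = record
      { isModel = record
        { nonEmpty              = nonEmpty
        ; isEquivalence         = isEquivalence
        ; isWellFoundedPreorder = λ i w →
            upgrade-isWellFoundedPreorder (Structure.leq M i w) (⟦ φ ⟧ M) em
              (isWellFoundedPreorder i w)
        }
      ; uniform = λ i w v w∼v x y → mk⇔ (shift w∼v) (shift (∼.sym i w∼v))
      }
      where
      open IsUniformModel uM

      shift : ∀ {i w v x y} → Structure.sim M i w v →
              Structure.leq (M ⇑ φ) i w x y → Structure.leq (M ⇑ φ) i v x y
      shift w∼v (inj₁ (x≤y , r))        = inj₁ (≤-shift w∼v x≤y , r)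
      shift w∼v (inj₂ (inj₁ (x≤y , r))) = inj₂ (inj₁ (≤-shift w∼v x≤y , r))
      shift w∼v (inj₂ (inj₂ r))         = inj₂ (inj₂ r)

    ⇑-B⁺-zig :
      ∀ {M M′ Z} φ → UniformBisimulation M M′ Z →
      ∀ {w w′} → Z w w′ → ∀ i v →
      Structure.sim M i w v → Structure.leq (M ⇑ φ) i w v w →
      ∃[ v′ ] Z v v′ × Structure.sim M′ i w′ v′ × Structure.leq (M′ ⇑ φ) i w′ v′ w′
    ⇑-B⁺-zig φ Zb z i v w∼v (inj₁ (v≤w , v⊨φ , w⊨φ)) =
      let v′ , zv , w′∼v′ , v′≤w′ = UniformBisimulation.B⁺-zig Zb z i v w∼v v≤w in
      v′ , zv , w′∼v′ , inj₁ (v′≤w′ , ⊨-transfer φ Zb zv v⊨φ , ⊨-transfer φ Zb z w⊨φ)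
    ⇑-B⁺-zig φ Zb z i v w∼v (inj₂ (inj₁ (v≤w , v⊭φ , w⊭φ))) =
      let v′ , zv , w′∼v′ , v′≤w′ = UniformBisimulation.B⁺-zig Zb z i v w∼v v≤w in
      v′ , zv , w′∼v′ ,
      inj₂ (inj₁ (v′≤w′ , ⊨-transfer (neg φ) Zb zv v⊭φ , ⊨-transfer (neg φ) Zb z w⊭φ))
    -- Here nothing is known about `v` and `w` in the old order, so the partner comes from `K-zig`;
    -- it is below `w′` by the truth values of `φ` alone.
    ⇑-B⁺-zig φ Zb z i v w∼v (inj₂ (inj₂ (v⊨φ , w⊭φ))) =
      let v′ , zv , w′∼v′ = UniformBisimulation.K-zig Zb z i v w∼v in
      v′ , zv , w′∼v′ , inj₂ (inj₂ (⊨-transfer φ Zb zv v⊨φ , ⊨-transfer (neg φ) Zb z w⊭φ))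

    ⇑-bisimulation :
      ∀ {M M′ Z} φ → UniformBisimulation M M′ Z → UniformBisimulation (M ⇑ φ) (M′ ⇑ φ) Z
    ⇑-bisimulation φ Zb = record
      { left  = ⇑-isUniformModel φ left
      ; right = ⇑-isUniformModel φ right
      ; isBisimulation = record
        { atoms  = atoms
        ; K-zig  = K-zig
        ; K-zag  = K-zag
        ; B⁺-zig = ⇑-B⁺-zig φ Zb
        ; B⁺-zag = ⇑-B⁺-zig φ (converse Zb)
        }
      }
      where open UniformBisimulation Zb

theorem29 : ∀ {g p ℓ} → ExcludedMiddle ℓ →
    (G : Set g) → G →
    (Atom : Set p) → Atom ⤖ ℕ →
    (M M′ : Structure G Atom ℓ) →
    IsEpistemicPlausibilityModel M → IsEpistemicPlausibilityModel M′ →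
    Uniform M → Uniform M′ →
    LocallyConnected M → LocallyConnected M′ →
    (w : Structure.W M) (w′ : Structure.W M′) →
    (Z : REL (Structure.W M) (Structure.W M′) ℓ) → IsBisimulation M M′ Z → Z w w′ →
    (φ : Formula G Atom) →
    ((h : M ∣ w ⊨ φ) (h′ : M′ ∣ w′ ⊨ φ) (ψ : Formula G Atom) →
    (M ! φ ∣ (w , [ h ]) ⊨ ψ) ⇔ (M′ ! φ ∣ (w′ , [ h′ ]) ⊨ ψ))
    × ((ψ : Formula G Atom) →
    (M ⇑ φ ∣ w ⊨ ψ) ⇔ (M′ ⇑ φ ∣ w′ ⊨ ψ))
theorem29 em G _ Atom _ M M′ isM isM′ uni uni′ _ _ w w′ Z bisim z φ =
    (λ h h′ ψ → ⊨-invariant ψ (!-bisimulation φ (w , [ h ]) (w′ , [ h′ ]) Zb) z)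
  , λ ψ → ⊨-invariant ψ (⇑-bisimulation em φ Zb) z
  where
  Zb : UniformBisimulation M M′ Z
  Zb = record
    { left           = record { isModel = isM  ; uniform = uni  }
    ; right          = record { isModel = isM′ ; uniform = uni′ }
    ; isBisimulation = bisim
    }
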